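{- Let $A$ and $B$ be meet-semilattices such that, identifying $A$ with its image $\{{\downarrow}a : a\in A\}$ in $\mathcal{BL} A$, we have $A\subseteq B\subseteq \mathcal{BL} A$ with $A$ a sub-meet-semilattice of $B$ and $B$ a sub-meet-semilattice of $\mathcal{BL} A$. Then $\mathcal{BL} B\cong \mathcal{BL} A$.
   Context: A meet-semilattice is a poset in which all finite meets exist (so it has a top $1$ but need not have a bottom). For a meet-semilattice $A$, a subset $S\subseteq A$ whose join $\bigvee S$ exists in $A$ is called admissible (and $\bigvee S$ a distributive join) if for every $a\in A$ the join $\bigvee\{a\wedge s: s\in S\}$ exists and equals $a\wedge\bigvee S$. A downset $E$ of $A$ is a D-ideal if $\bigvee S\in E$ for every admissible $S\subseteq E$. The Bruns–Lakser completion $\mathcal{BL} A$ is the set of all D-ideals of $A$ ordered by inclusion; it is a frame, and $a\mapsto {\downarrow}a$ embeds $A$ as a join-dense sub-meet-semilattice of $\mathcal{BL} A$. -}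

module Defs where

open import Level using (Level; _⊔_; suc; Lift; lift; lower)
open import Data.Product.Base using (_×_; _,_; proj₁; proj₂; ∃-syntax)
import Data.Unit.Polymorphic.Base as Unit
open import Function.Base using (id; _∘_)
open import Relation.Binary.Bundles using (Poset)
open import Relation.Binary.Lattice.Bundles using (BoundedMeetSemilattice)
open import Relation.Binary.Morphism.Structures using (IsOrderMonomorphism; IsOrderIsomorphism)
open import Relation.Unary using (Pred; _∈_; _⊆_; _∩_)

-- A meet-semilattice with all finite meets, hence with a top, is a
-- BoundedMeetSemilattice of the library.

module _ {c ℓ₁ ℓ₂ : Level} (A : BoundedMeetSemilattice c ℓ₁ ℓ₂) where

  open BoundedMeetSemilattice A

  record IsJoin {p : Level} (S : Pred Carrier p) (j : Carrier) : Set (c ⊔ ℓ₂ ⊔ p) where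
    field
      upper : ∀ {s} → s ∈ S → s ≤ j
      least : ∀ {u} → (∀ {s} → s ∈ S → s ≤ u) → j ≤ u

  MeetWith : {p : Level} → Carrier → Pred Carrier p → Pred Carrier (c ⊔ ℓ₁ ⊔ p)
  MeetWith a S x = ∃[ s ] (s ∈ S × x ≈ a ∧ s)

  record Admissible {p : Level} (S : Pred Carrier p) : Set (c ⊔ ℓ₁ ⊔ ℓ₂ ⊔ p) where
    field
      ⋁            : Carrier
      isJoin       : IsJoin S ⋁
      distributive : ∀ a → IsJoin (MeetWith a S) (a ∧ ⋁)

  -- Subsets are predicates with values in Set p, where p is chosen
  -- independently of the levels of A: Set p plays the role of the truth
  -- values, both for the D-ideals E and for the admissible S.  If p is at least
  -- ℓ₂, closure under S at level p already gives closure under S at every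
  -- level, since S may be enlarged to E ∩ ↓ (⋁ S), which has the same join.
  record DIdeal (p : Level) : Set (c ⊔ ℓ₁ ⊔ ℓ₂ ⊔ suc p) where
    field
      member   : Pred Carrier p
      downset  : ∀ {x y} → x ≤ y → y ∈ member → x ∈ member
      ⋁-closed : {S : Pred Carrier p} (adm : Admissible S) →
                 S ⊆ member → Admissible.⋁ adm ∈ member

  open DIdeal

  𝓑𝓛 : (p : Level) → BoundedMeetSemilattice (c ⊔ ℓ₁ ⊔ ℓ₂ ⊔ suc p) (c ⊔ p) (c ⊔ p)
  𝓑𝓛 p = record
    { Carrier = DIdeal p
    ; _≈_     = λ E F → member E ⊆ member F × member F ⊆ member E
    ; _≤_     = λ E F → member E ⊆ member F
    ; _∧_     = λ E F → record
      { member   = member E ∩ member F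
      ; downset  = λ x≤y (y∈E , y∈F) → downset E x≤y y∈E , downset F x≤y y∈F
      ; ⋁-closed = λ adm S⊆E∩F →
          ⋁-closed E adm (proj₁ ∘ S⊆E∩F) , ⋁-closed F adm (proj₂ ∘ S⊆E∩F)
      }
    ; ⊤       = record
      { member   = λ _ → Unit.⊤
      ; downset  = λ _ _ → Unit.tt
      ; ⋁-closed = λ _ _ → Unit.tt
      }
    ; isBoundedMeetSemilattice = record
      { isMeetSemilattice = record
        { isPartialOrder = record
          { isPreorder = record
            { isEquivalence = record
              { refl  = id , id
              ; sym   = λ (f , g) → g , f
              ; trans = λ (f , g) (h , k) → h ∘ f , g ∘ k
              }
            ; reflexive = proj₁
            ; trans     = λ f g → g ∘ f
            }
          ; antisym = _,_
          }
        ; infimum = λ _ _ → proj₁ , proj₂ , λ _ f g x → f x , g x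
        }
      ; maximum = λ _ _ → Unit.tt
      }
    }

  -- The Lift only makes ↓ a available in every 𝓑𝓛 whose level is at least ℓ₂.
  ↓ : (p : Level) → Carrier → DIdeal (ℓ₂ ⊔ p)
  ↓ p a = record
    { member   = λ x → Lift p (x ≤ a)
    ; downset  = λ x≤y y≤a → lift (trans x≤y (lower y≤a))
    ; ⋁-closed = λ adm S⊆↓a → lift (IsJoin.least (Admissible.isJoin adm) (lower ∘ S⊆↓a))
    }

-- f exhibits A as a sub-meet-semilattice of B, up to identification of A
-- with its image.
record IsSubMeetSemilattice
  {a a₁ a₂ b b₁ b₂ : Level}
  (A : BoundedMeetSemilattice a a₁ a₂) (B : BoundedMeetSemilattice b b₁ b₂)
  (f : BoundedMeetSemilattice.Carrier A → BoundedMeetSemilattice.Carrier B) :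
  Set (a ⊔ a₁ ⊔ a₂ ⊔ b ⊔ b₁ ⊔ b₂) where
  private
    module A = BoundedMeetSemilattice A
    module B = BoundedMeetSemilattice B
  field
    isOrderMonomorphism : IsOrderMonomorphism A._≈_ B._≈_ A._≤_ B._≤_ f
    ∧-homo              : ∀ x y → f (x A.∧ y) B.≈ f x B.∧ f y
    ⊤-homo              : f A.⊤ B.≈ B.⊤

infix 4 _≅_

_≅_ : {p p₁ p₂ q q₁ q₂ : Level} → Poset p p₁ p₂ → Poset q q₁ q₂ → Set (p ⊔ p₁ ⊔ p₂ ⊔ q ⊔ q₁ ⊔ q₂)
P ≅ Q = ∃[ f ] IsOrderIsomorphism P._≈_ Q._≈_ P._≤_ Q._≤_ f
  where
  module P = Poset P
  module Q = Poset Q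

{-# OPTIONS --safe #-}

-- The isomorphism restricts a D-ideal E of B to A; its inverse sends a D-ideal F
-- of A to the set of those y in B that lie below F in 𝓑𝓛 A.  Distributive joins of
-- A stay distributive joins in B, since the D-ideals j u do not distinguish them,
-- and every y in B is the distributive join of the elements of A below it, so E is
-- recovered from its restriction.  Conversely, if T ⊆ B lies below F and
-- x ≤ ⋁ T with x in A, then x is the distributive join of the elements of F below x.
module Submission where

open import Level using (Level; _⊔_; lift; lower)
open import Data.Product.Base using (_×_; _,_; proj₁; proj₂; ∃-syntax)
open import Function.Base using (_∘_)
open import Relation.Binary.Lattice.Bundles using (BoundedMeetSemilattice)
import Relation.Binary.Lattice.Properties.MeetSemilattice as MeetSemilatticeProperties
open import Relation.Binary.Morphism.Structures using (IsOrderMonomorphism; IsOrderIsomorphism)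
open import Relation.Unary using (Pred; _∈_; _⊆_)
open import Defs
open BoundedMeetSemilattice using (Carrier)
open BoundedMeetSemilattice using (poset)

module _ {c ℓ₁ ℓ₂ : Level} (A : BoundedMeetSemilattice c ℓ₁ ℓ₂) where

  open BoundedMeetSemilattice A hiding (Carrier)
  open MeetSemilatticeProperties meetSemilattice using (∧-assoc; ∧-monotonic)

  ∧-monoʳ : ∀ x {y z} → y ≤ z → x ∧ y ≤ x ∧ z
  ∧-monoʳ x y≤z = ∧-monotonic refl y≤z

  meet-join-mono : ∀ {p} {S : Pred (Carrier A) p} (adm : Admissible A S) (x : Carrier A) {s} →
                   s ∈ S → x ∧ s ≤ x ∧ Admissible.⋁ adm
  meet-join-mono adm x s∈S = ∧-monoʳ x (IsJoin.upper (Admissible.isJoin adm) s∈S)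

  -- MeetWith lives at a level that includes ℓ₁; this copy of it avoids that.
  Meets : ∀ {p} → Carrier A → Pred (Carrier A) p → Pred (Carrier A) (c ⊔ ℓ₂ ⊔ p)
  Meets x S y = ∃[ s ] (s ∈ S × y ≤ x ∧ s × x ∧ s ≤ y)

  -- Distributivity at `a` is that of `S` at `a ∧ x`, by associativity.
  Meets-admissible : ∀ {p} {S : Pred (Carrier A) p} (adm : Admissible A S) (x : Carrier A) →
                     Admissible A (Meets x S)
  Meets-admissible adm x = record
    { ⋁            = x ∧ ⋁
    ; isJoin       = record
      { upper = λ (_ , s∈S , y≤ , _) → trans y≤ (meet-join-mono adm x s∈S)
      ; least = λ ub → IsJoin.least (distributive x)
          λ (s , s∈S , y≈) → trans (reflexive y≈) (ub (s , s∈S , refl , refl))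
      }
    ; distributive = λ a → record
      { upper = λ (_ , (_ , s∈S , y≤ , _) , z≈) →
          trans (reflexive z≈) (∧-monoʳ a (trans y≤ (meet-join-mono adm x s∈S)))
      ; least = λ ub → trans (reflexive (Eq.sym (∧-assoc a x ⋁))) (IsJoin.least (distributive (a ∧ x))
          λ (s , s∈S , z≈) → ub (x ∧ s , (s , s∈S , refl , refl) , Eq.trans z≈ (∧-assoc a x s)))
      }
    }
    where open Admissible adm

  -- Such an `x` equals `x ∧ ⋁`, the distributive join of the meets `x ∧ s`. The shape of the level
  -- keeps `Meets x S` at the level of `E`, where closure applies.
  ⋁-closed-below : ∀ r {S : Pred (Carrier A) (c ⊔ ℓ₂ ⊔ r)} (E : DIdeal A (c ⊔ ℓ₂ ⊔ r))
                   (adm : Admissible A S) {x : Carrier A} → x ≤ Admissible.⋁ adm →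
                   (∀ {s} → s ∈ S → x ∧ s ∈ DIdeal.member E) → x ∈ DIdeal.member E
  ⋁-closed-below r E adm {x} x≤⋁ x∧S⊆E =
    DIdeal.downset E (∧-greatest refl x≤⋁)
      (DIdeal.⋁-closed E (Meets-admissible adm x)
        λ (_ , s∈S , y≤ , _) → DIdeal.downset E y≤ (x∧S⊆E s∈S))

module Extension
  {a a₁ a₂ b b₁ b₂ : Level} (r : Level)
  (A : BoundedMeetSemilattice a a₁ a₂) (B : BoundedMeetSemilattice b b₁ b₂)
  (i : Carrier A → Carrier B) (j : Carrier B → Carrier (𝓑𝓛 A (a ⊔ a₂ ⊔ r)))
  (i-sub : IsSubMeetSemilattice A B i)
  (j-sub : IsSubMeetSemilattice B (𝓑𝓛 A (a ⊔ a₂ ⊔ r)) j)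
  (j∘i≈↓ : ∀ x → BoundedMeetSemilattice._≈_ (𝓑𝓛 A (a ⊔ a₂ ⊔ r)) (j (i x)) (↓ A (a ⊔ a₂ ⊔ r) x))
  where

  private
    -- Absorbing the carrier and order levels of `A` keeps `Below F x` and `extend F` at level `p`,
    -- whatever the levels of `B`.
    p : Level
    p = a ⊔ a₂ ⊔ r
    module A = BoundedMeetSemilattice A
    module B = BoundedMeetSemilattice B
    module 𝓐 = BoundedMeetSemilattice (𝓑𝓛 A p)
    module i = IsOrderMonomorphism (IsSubMeetSemilattice.isOrderMonomorphism i-sub)
    module j = IsOrderMonomorphism (IsSubMeetSemilattice.isOrderMonomorphism j-sub)

  open DIdeal

  -- `x ∈ j y` makes `↓ x` a subset of `j y`, and `j` reflects the order. With the converse below,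
  -- `j y` is the trace on `A` of the principal downset of `y`, so comparisons in `B` can be tested
  -- on elements of `A`.
  ∈j⇒i≤ : ∀ {x y} → x ∈ member (j y) → i x B.≤ y
  ∈j⇒i≤ {x} {y} x∈jy = j.cancel
    λ z∈jix → downset (j y) (lower (proj₁ (j∘i≈↓ x) z∈jix)) x∈jy

  i≤⇒∈j : ∀ {x y} → i x B.≤ y → x ∈ member (j y)
  i≤⇒∈j {x} ix≤y = j.mono ix≤y (proj₂ (j∘i≈↓ x) (lift A.refl))

  -- The condition j y ≈ ↓ s says y ≈ i s at a level independent of those of B.
  Image : Pred A.Carrier p → Pred B.Carrier p
  Image S y = ∃[ s ] (s ∈ S × j y 𝓐.≈ ↓ A p s)

  i∈Image : ∀ {S s} → s ∈ S → i s ∈ Image S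
  i∈Image {s = s} s∈S = s , s∈S , j∘i≈↓ s

  Image⇒≤i : ∀ {y s} → j y 𝓐.≈ ↓ A p s → y B.≤ i s
  Image⇒≤i {y} {s} jy≈↓s = j.cancel (proj₂ (j∘i≈↓ s) ∘ proj₁ jy≈↓s)

  -- The last hypothesis says that j y is contained in the join in 𝓑𝓛 A of the ↓ s
  -- with s ∈ S.
  Image-admissible :
    (S : Pred A.Carrier p) (y : B.Carrier) → S ⊆ member (j y) →
    (∀ (F : DIdeal A p) {x} → x ∈ member (j y) →
      (∀ {s} → s ∈ S → x A.∧ s ∈ member F) → x ∈ member F) →
    Admissible B (Image S)
  Image-admissible S y S⊆jy covers = record
    { ⋁            = y
    ; isJoin       = record
      { upper = Image≤y
      ; least = λ {u} ub → j.cancel λ {x} x∈jy → covers (j u) x∈jy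
          λ s∈S → downset (j u) (A.x∧y≤y x _) (i≤⇒∈j (ub (i∈Image s∈S)))
      }
    ; distributive = λ d → record
      { upper = λ (_ , t∈ , z≈) → B.trans (B.reflexive z≈) (∧-monoʳ B d (Image≤y t∈))
      -- An `x` in `j (d ∧ y)` has `i x ≤ d`, so `i (x ∧ s)` lies below `d ∧ i s`, hence below `u`;
      -- covering with `j u` then gives `x ∈ j u`.
      ; least = λ {u} ub → j.cancel λ {x} x∈j[d∧y] →
          covers (j u) (j.mono (B.x∧y≤y d y) x∈j[d∧y])
            λ {s} s∈S → i≤⇒∈j (B.trans
              (B.∧-greatest
                (B.trans (i.mono (A.x∧y≤x x s)) (B.trans (∈j⇒i≤ x∈j[d∧y]) (B.x∧y≤x d y)))
                (i.mono (A.x∧y≤y x s)))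
              (ub (i s , i∈Image s∈S , B.Eq.refl)))
      }
    }
    where
    Image≤y : ∀ {t} → t ∈ Image S → t B.≤ y
    Image≤y (_ , s∈S , jt≈↓s) = B.trans (Image⇒≤i jt≈↓s) (∈j⇒i≤ (S⊆jy s∈S))

  restrict : DIdeal B p → DIdeal A p
  restrict E = record
    { member   = member E ∘ i
    ; downset  = downset E ∘ i.mono
    ; ⋁-closed = λ {S} adm S⊆E → ⋁-closed E
        (Image-admissible S (i (Admissible.⋁ adm))
          (λ s∈S → i≤⇒∈j (i.mono (IsJoin.upper (Admissible.isJoin adm) s∈S)))
          -- Elements of `j (i (⋁ S))` are the elements of `A` below `⋁ S`.
          (λ F x∈ → ⋁-closed-below A r F adm (i.cancel (∈j⇒i≤ x∈))))
        λ (_ , s∈S , jy≈↓s) → downset E (Image⇒≤i jy≈↓s) (S⊆E s∈S)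
    }

  Below : DIdeal A p → A.Carrier → Pred A.Carrier p
  Below F x s = s A.≤ x × s ∈ member F

  -- By distributivity of `T` at `i x`, the element `i x` is the join of the `i x ∧ t`. Elements of
  -- `A` under `i x ∧ t` belong to `Below F x`, so each `i x ∧ t` is at most `i u`.
  Below-least : (F : DIdeal A p) {T : Pred B.Carrier p} (adm : Admissible B T) →
    (∀ {t} → t ∈ T → member (j t) ⊆ member F) →
    ∀ {x u} → x ∈ member (j (Admissible.⋁ adm)) →
    (∀ {s} → s ∈ Below F x → s A.≤ u) → x A.≤ u
  Below-least F adm T⊆F {x} {u} x∈j⋁T ub = i.cancel (B.trans
    (B.∧-greatest B.refl (∈j⇒i≤ x∈j⋁T))
    (IsJoin.least (Admissible.distributive adm (i x)) λ (t , t∈T , z≈) →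
      B.trans (B.reflexive z≈) (j.cancel λ {s} s∈ → i≤⇒∈j (i.mono (ub
        ( i.cancel (B.trans (∈j⇒i≤ s∈) (B.x∧y≤x (i x) t))
        , T⊆F t∈T (j.mono (B.x∧y≤y (i x) t) s∈)))))))

  Below-admissible : (F : DIdeal A p) {T : Pred B.Carrier p} (adm : Admissible B T) →
    (∀ {t} → t ∈ T → member (j t) ⊆ member F) →
    ∀ {x} → x ∈ member (j (Admissible.⋁ adm)) → Admissible A (Below F x)
  Below-admissible F adm T⊆F {x} x∈j⋁T = record
    { ⋁            = x
    ; isJoin       = record
      { upper = proj₁
      ; least = Below-least F adm T⊆F x∈j⋁T
      }
    ; distributive = λ d → record
      { upper = λ (_ , (s≤x , _) , z≈) → A.trans (A.reflexive z≈) (∧-monoʳ A d s≤x)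
      -- `Below-least` is applied to `d ∧ x`: each `s` in `Below F (d ∧ x)` lies in `Below F x` and
      -- satisfies `s ≤ d ∧ s`.
      ; least = λ ub →
          Below-least F adm T⊆F (downset (j (Admissible.⋁ adm)) (A.x∧y≤y d x) x∈j⋁T)
            λ {s} (s≤d∧x , s∈F) → A.trans
              (A.∧-greatest (A.trans s≤d∧x (A.x∧y≤x d x)) A.refl)
              (ub (s , (A.trans s≤d∧x (A.x∧y≤y d x) , s∈F) , A.Eq.refl))
      }
    }

  extend : DIdeal A p → DIdeal B p
  extend F = record
    { member   = λ y → ∀ {x} → x ∈ member (j y) → x ∈ member F
    ; downset  = λ y≤z jz⊆F x∈jy → jz⊆F (j.mono y≤z x∈jy)
    ; ⋁-closed = λ adm T⊆F x∈j⋁T →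
        ⋁-closed F (Below-admissible F adm (λ t∈T → T⊆F t∈T) x∈j⋁T) proj₂
    }

  restrict-cancel : ∀ {E E′} → member (restrict E) ⊆ member (restrict E′) → member E ⊆ member E′
  restrict-cancel {E} {E′} E⊆E′ {y} y∈E = ⋁-closed E′
    (Image-admissible (member (j y)) y (λ x∈jy → x∈jy)
      -- Here `x` itself is a member of the family, so covering reduces to `x ≤ x ∧ x`.
      (λ F {x} x∈jy x∧jy⊆F → downset F (A.∧-greatest A.refl A.refl) (x∧jy⊆F x∈jy)))
    λ (_ , x∈jy , jz≈↓x) →
      downset E′ (Image⇒≤i jz≈↓x) (E⊆E′ (downset E (∈j⇒i≤ x∈jy) y∈E))

  -- `j (i x)` is `↓ x`, and a downset contains `↓ x` exactly when it contains `x`.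
  restrict-extend : ∀ F → restrict (extend F) 𝓐.≈ F
  restrict-extend F =
      (λ {x} jix⊆F → jix⊆F (i≤⇒∈j B.refl))
    , (λ {x} x∈F z∈jix → downset F (i.cancel (∈j⇒i≤ z∈jix)) x∈F)

  restrict-isOrderIsomorphism : IsOrderIsomorphism
    (BoundedMeetSemilattice._≈_ (𝓑𝓛 B p)) 𝓐._≈_
    (BoundedMeetSemilattice._≤_ (𝓑𝓛 B p)) 𝓐._≤_ restrict
  restrict-isOrderIsomorphism = record
    { isOrderMonomorphism = record
      { isOrderHomomorphism = record
        { cong = λ (E⊆E′ , E′⊆E) → (λ x∈ → E⊆E′ x∈) , (λ x∈ → E′⊆E x∈)
        ; mono = λ E⊆E′ x∈ → E⊆E′ x∈
        }
      ; injective = λ {E} {E′} (E⊆E′ , E′⊆E) →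
          restrict-cancel {E} {E′} E⊆E′ , restrict-cancel {E′} {E} E′⊆E
      ; cancel    = λ {E} {E′} → restrict-cancel {E} {E′}
      }
    ; surjective = λ F → extend F , λ (E⊆ , ⊆E) →
        (λ x∈E → proj₁ (restrict-extend F) (E⊆ x∈E)) ,
        (λ x∈F → ⊆E (proj₂ (restrict-extend F) x∈F))
    }

theorem3p5 : {a a₁ a₂ b b₁ b₂ : Level} (r : Level)
    (A : BoundedMeetSemilattice a a₁ a₂) (B : BoundedMeetSemilattice b b₁ b₂)
    (i : Carrier A → Carrier B) (j : Carrier B → Carrier (𝓑𝓛 A (a ⊔ a₂ ⊔ r))) →
    IsSubMeetSemilattice A B i →
    IsSubMeetSemilattice B (𝓑𝓛 A (a ⊔ a₂ ⊔ r)) j →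
    (∀ x → BoundedMeetSemilattice._≈_ (𝓑𝓛 A (a ⊔ a₂ ⊔ r)) (j (i x)) (↓ A (a ⊔ a₂ ⊔ r) x)) →
    poset (𝓑𝓛 B (a ⊔ a₂ ⊔ r)) ≅ poset (𝓑𝓛 A (a ⊔ a₂ ⊔ r))
theorem3p5 r A B i j i-sub j-sub j∘i≈↓ = restrict , restrict-isOrderIsomorphism
  where open Extension r A B i j i-sub j-sub j∘i≈↓
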